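{- Let $q$ be a prime power and let $n,m,t$ be integers with $1\le t\le m-1$ and $n\ge 2m$. Then $$\chi(J_q(n,m,t))\le (1+o(1))\,n^{m-t}q^{(n-m)(m-t)}.$$
   Context: For a prime power $q$ and integers $n>m$ and $1\le t\le m-1$, $J_q(n,m,t)$ is the graph whose vertices are the $m$-dimensional subspaces of $\mathbb{F}_q^n$, with two distinct vertices adjacent if and only if their intersection has dimension at least $t$. $\chi$ denotes the chromatic number. -}

module Defs where

open import Algebra.Apartness.Bundles using (HeytingField; HeytingCommutativeRing)
open import Algebra.Bundles using (CommutativeRing)
open import Data.Fin.Base using (Fin)
open import Data.Nat.Base using (ℕ; _≤_; _^_)
open import Data.Nat.Primality using (Prime)
open import Data.Product.Base using (Σ; ∃; ∃₂; _×_; _,_; proj₁; proj₂; swap)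
open import Data.Rational.Base as ℚ using (ℚ; 0ℚ)
open import Data.Vec.Functional using (Vector)
open import Function.Base using (_∘_)
open import Function.Bundles using (Inverse)
open import Level using (Level; _⊔_; suc; 0ℓ)
open import Relation.Binary.Bundles using (Setoid)
open import Relation.Binary.Core using (Rel)
open import Relation.Binary.Definitions using (Symmetric; Irreflexive; _Respects₂_)
open import Relation.Binary.PropositionalEquality.Core using (_≡_; _≢_)
import Relation.Binary.PropositionalEquality.Properties as ≡
open import Relation.Nullary.Negation using (¬_)
open import Relation.Unary using (Pred; _∈_; _≐_; _∩_)
open import Relation.Unary.Relation.Binary.Equality using (≐-setoid)
import Relation.Binary.Construct.On as On

private
  variable
    c ℓ ℓ₁ ℓ₂ : Level

IsPrimePower : ℕ → Set
IsPrimePower q = ∃₂ λ p k → Prime p × 1 ≤ k × q ≡ p ^ k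

-- In the presence of a bijection with Fin q, equality and apartness are
-- decidable, so a Heyting field of order q is exactly a finite field 𝔽_q.
HasOrder : HeytingField c ℓ₁ ℓ₂ → ℕ → Set (c ⊔ ℓ₁)
HasOrder F q = Inverse (CommutativeRing.setoid commutativeRing) (≡.setoid (Fin q))
  where open HeytingCommutativeRing (HeytingField.heytingCommutativeRing F)
          using (commutativeRing)

TendsToZero : (ℕ → ℚ) → Set
TendsToZero f = ∀ (ε : ℚ) → 0ℚ ℚ.< ε → ∃ λ N → ∀ n → N ≤ n → ℚ.∣ f n ∣ ℚ.< ε

-- Simple graphs on a setoid of vertices.
record Graph (v e r : Level) : Set (suc (v ⊔ e ⊔ r)) where
  field
    vertices : Setoid v e

  open Setoid vertices public renaming (Carrier to Vertex)
    using (_≈_)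

  field
    Adjacent     : Rel Vertex r
    adj-sym      : Symmetric Adjacent
    adj-irrefl   : Irreflexive _≈_ Adjacent
    adj-resp-≈   : Adjacent Respects₂ _≈_

module _ {v e r} (G : Graph v e r) where
  open Graph G

  record ProperColouring (k : ℕ) : Set (v ⊔ e ⊔ r) where
    field
      colour : Vertex → Fin k
      cong   : ∀ {x y} → x ≈ y → colour x ≡ colour y
      proper : ∀ {x y} → Adjacent x y → colour x ≢ colour y

  IsChromaticNumber : ℕ → Set (v ⊔ e ⊔ r)
  IsChromaticNumber χ = ProperColouring χ × (∀ k → ProperColouring k → χ ≤ k)

module LinearAlgebra (F : HeytingField c ℓ₁ ℓ₂) where
  open HeytingCommutativeRing (HeytingField.heytingCommutativeRing F)
    using (commutativeRing)
  open CommutativeRing commutativeRing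
    using (Carrier; _≈_; _+_; _*_; 0#; +-rawMonoid)
  open import Algebra.Definitions.RawMonoid +-rawMonoid using (sum)

  Vec : ℕ → Set c
  Vec n = Vector Carrier n

  infix 4 _≋_
  _≋_ : ∀ {n} → Rel (Vec n) ℓ₁
  v ≋ w = ∀ i → v i ≈ w i

  𝟎 : ∀ {n} → Vec n
  𝟎 _ = 0#

  infixl 6 _⊞_
  _⊞_ : ∀ {n} → Vec n → Vec n → Vec n
  (v ⊞ w) i = v i + w i

  infixr 7 _⊡_
  _⊡_ : ∀ {n} → Carrier → Vec n → Vec n
  (a ⊡ v) i = a * v i

  combination : ∀ {n d} → Vec d → Vector (Vec n) d → Vec n
  combination a b j = sum λ i → a i * b i j

  -- The level c ⊔ ℓ₁ is the one at which the span of a finite family lives.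
  record Subspace (n : ℕ) : Set (suc (c ⊔ ℓ₁)) where
    field
      member   : Pred (Vec n) (c ⊔ ℓ₁)
      resp-≋   : ∀ {v w} → v ≋ w → v ∈ member → w ∈ member
      𝟎-closed : 𝟎 ∈ member
      ⊞-closed : ∀ {v w} → v ∈ member → w ∈ member → v ⊞ w ∈ member
      ⊡-closed : ∀ a {v} → v ∈ member → a ⊡ v ∈ member

  open Subspace public

  infixr 7 _⊓_
  _⊓_ : ∀ {n} → Subspace n → Subspace n → Subspace n
  U ⊓ V = record
    { member   = member U ∩ member V
    ; resp-≋   = λ eq (u , v) → resp-≋ U eq u , resp-≋ V eq v
    ; 𝟎-closed = 𝟎-closed U , 𝟎-closed V
    ; ⊞-closed = λ (u , v) (u′ , v′) → ⊞-closed U u u′ , ⊞-closed V v v′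
    ; ⊡-closed = λ a (u , v) → ⊡-closed U a u , ⊡-closed V a v
    }

  LinearlyIndependent : ∀ {n d} → Vector (Vec n) d → Set (c ⊔ ℓ₁)
  LinearlyIndependent b = ∀ a → combination a b ≋ 𝟎 → a ≋ 𝟎

  record IsBasis {n d} (U : Subspace n) (b : Vector (Vec n) d) : Set (c ⊔ ℓ₁) where
    field
      inside      : ∀ i → b i ∈ member U
      independent : LinearlyIndependent b
      spanning    : ∀ {v} → v ∈ member U → ∃ λ a → v ≋ combination a b

  HasDim : ∀ {n} → Subspace n → ℕ → Set (c ⊔ ℓ₁)
  HasDim {n} U d = ∃ λ (b : Vector (Vec n) d) → IsBasis U b

  HasDim-resp : ∀ {n d} (U V : Subspace n) → member U ≐ member V →
                HasDim U d → HasDim V d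
  HasDim-resp U V (U⊆V , V⊆U) (b , B) = b , record
    { inside      = λ i → U⊆V (inside i)
    ; independent = independent
    ; spanning    = λ v∈V → spanning (V⊆U v∈V)
    }
    where open IsBasis B

  Grassmannian : ℕ → ℕ → Setoid (suc (c ⊔ ℓ₁)) (c ⊔ ℓ₁)
  Grassmannian n m = On.setoid {B = Σ (Subspace n) λ U → HasDim U m}
    (≐-setoid (Vec n) (c ⊔ ℓ₁)) (member ∘ proj₁)

-- The graph J_q(n,m,t), where q is the order of F.
J : (F : HeytingField c ℓ₁ ℓ₂) (n m t : ℕ) →
    Graph (suc (c ⊔ ℓ₁)) (c ⊔ ℓ₁) (c ⊔ ℓ₁)
J {c} {ℓ₁} F n m t = record
  { vertices   = Grassmannian n m
  ; Adjacent   = Adj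
  ; adj-sym    = λ {x} {y} → adj-sym {x} {y}
  ; adj-irrefl = λ x≈y (x≉y , _) → x≉y x≈y
  ; adj-resp-≈ = (λ {x} {y} {z} → respʳ {x} {y} {z})
               , (λ {x} {y} {z} y≈z yx →
                    adj-sym {x} {z} (respʳ {x} {y} {z} y≈z (adj-sym {y} {x} yx)))
  }
  where
  open LinearAlgebra F
  open Setoid (Grassmannian n m) renaming (Carrier to Vertex) using (_≈_)

  Adj : Rel Vertex (c ⊔ ℓ₁)
  Adj x@(U , _) y@(V , _) = ¬ (x ≈ y) × ∃ λ d → t ≤ d × HasDim (U ⊓ V) d

  adj-sym : ∀ {x y} → Adj x y → Adj y x
  adj-sym {U , _} {V , _} (x≉y , d , t≤d , D) =
    (λ y≈x → x≉y (swap y≈x)) , d , t≤d , HasDim-resp (U ⊓ V) (V ⊓ U) (swap , swap) D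

  respʳ : ∀ {x y z} → y ≈ z → Adj x y → Adj x z
  respʳ {U , _} {V , _} {W , _} (V⊆W , W⊆V) (x≉y , d , t≤d , D) =
    (λ (U⊆W , W⊆U) → x≉y ((λ u → W⊆V (U⊆W u)) , (λ v → W⊆U (V⊆W v)))) ,
    d , t≤d , HasDim-resp (U ⊓ V) (U ⊓ W)
      ((λ (u , v) → u , V⊆W v) , (λ (u , w) → u , W⊆V w)) D

{-# OPTIONS --safe #-}
-- Greedy colouring gives far more than is asked: χ = O(q^((n∸m)(m∸t))), with no
-- power of n.  If dim (U ∩ V) ≥ t, then V is spanned by t vectors of U, given by
-- their coordinates in a basis of U, and m ∸ t further vectors of the ambient
-- space.  Hence U has at most q^(mt) q^(n(m∸t)) = q^(m²) q^((n∸m)(m∸t)) neighbours,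
-- and the constant factor is absorbed by 1 + o(1) times n^(m∸t) ≥ n.
-- Everything is finite, so existence of a colouring with k colours is decidable,
-- and the chromatic number is the least such k.
module Submission where

open import Defs
open import Algebra.Apartness.Bundles using (HeytingField; HeytingCommutativeRing)
open import Algebra.Bundles using (CommutativeRing)
open import Data.Bool.Base using (Bool)
open import Data.Fin.Base using (Fin; zero; suc; combine; finToFun; funToFin)
open import Data.Fin.Properties
  using (any?; all?; _≟_; pigeonhole; injective⇒≤; ¬∀⟶∃¬; <⇒≢; 2↔Bool; combine-injective;
         funToFin-finToFin; finToFun-funToFin)
open import Data.Integer.Base as ℤ using (+_; +[1+_]; -[1+_])
import Data.Integer.Properties as ℤ
open import Data.Nat.Base
  using (ℕ; zero; suc; _≤_; _+_; _*_; _∸_; _^_; z≤n; s≤s;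
         NonZero; >-nonZero; nonTrivial⇒n>1; _≤′_; ≤′-reflexive; ≤′-step)
open import Data.Nat.Primality using (prime⇒nonTrivial; prime⇒nonZero)
import Data.Nat.Properties as ℕ
open import Data.Nat.Tactic.RingSolver using (solve-∀)
open import Data.Product.Base using (Σ; ∃; ∃₂; _×_; _,_; proj₁; proj₂)
open import Data.Rational.Base as ℚ using (ℚ; 0ℚ; 1ℚ; _/_)
import Data.Rational.Properties as ℚ
import Data.Rational.Unnormalised.Base as ℚᵘ
import Data.Rational.Unnormalised.Properties as ℚᵘ
open import Data.Vec.Functional as Vector using (Vector)
open import Function.Base using (_∘_)
open import Function.Bundles using (Inverse; mk⇔)
open import Level using (Level; _⊔_)
open import Relation.Binary.Bundles using (Setoid)
open import Relation.Binary.Core using (Rel)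
open import Relation.Binary.Definitions using (Symmetric) renaming (Decidable to Decidable₂)
open import Relation.Binary.PropositionalEquality.Core
  using (_≡_; _≢_; refl; sym; trans; cong; cong₂; subst; subst₂)
import Relation.Binary.PropositionalEquality.Properties as ≡
open import Relation.Nullary.Decidable
  using (Dec; yes; no; map′; ¬?; _×-dec_; _→-dec_; does; does-⇔)
open import Relation.Nullary.Negation using (¬_; contradiction)
open import Relation.Unary using (Pred; Decidable; _∈_; _∉_; _⊆_)
open import Data.Vec.Functional.Relation.Binary.Equality.Setoid using (≋-setoid)

private
  variable
    a b c e ℓ ℓ₁ ℓ₂ p r v : Level
    k m n N D : ℕ

-- Minimal witnesses and comparison of decisions.

least : {P : Pred ℕ p} → Decidable P → ∀ n → P n → ∃ λ k → P k × (∀ j → P j → k ≤ j) × k ≤ n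
least P? n Pn with P? 0
... | yes P0 = 0 , P0 , (λ _ _ → z≤n) , z≤n
least P? zero P0 | no ¬P0 = contradiction P0 ¬P0
least P? (suc n) Pn | no ¬P0 =
  let k , Pk , min , k≤n = least (P? ∘ suc) n Pn
  in suc k , Pk , (λ { zero P0 → contradiction P0 ¬P0 ; (suc j) Pj → s≤s (min j Pj) }) , s≤s k≤n

does-≡⇒ : {A : Set a} {B : Set b} (A? : Dec A) (B? : Dec B) → does A? ≡ does B? → A → B
does-≡⇒ (yes _) (yes y) _ _ = y
does-≡⇒ (no ¬x) _       _ x = contradiction x ¬x
does-≡⇒ (yes _) (no _)  ()

-- Finite setoids

Enumeration : Setoid c ℓ → ℕ → Set (c ⊔ ℓ)
Enumeration S N = Inverse S (≡.setoid (Fin N))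

funToFin-cong : {f g : Fin n → Fin m} → (∀ i → f i ≡ g i) → funToFin f ≡ funToFin g
funToFin-cong {n = zero}  f≗g = refl
funToFin-cong {n = suc n} f≗g = cong₂ combine (f≗g zero) (funToFin-cong (f≗g ∘ suc))

funToFin-injective : (f g : Fin n → Fin m) → funToFin f ≡ funToFin g → ∀ i → f i ≡ g i
funToFin-injective f g eq i =
  trans (sym (finToFun-funToFin f i)) (trans (cong (λ z → finToFun z i) eq) (finToFun-funToFin g i))

module _ {S : Setoid c ℓ} (I : Enumeration S N) where
  open Setoid S using (Carrier; _≈_) renaming (sym to ≈-sym; trans to ≈-trans; refl to ≈-refl)
  open Inverse I

  to-injective : ∀ {x y} → to x ≡ to y → x ≈ y
  to-injective {x} {y} eq =
    ≈-trans (≈-sym (strictlyInverseʳ x)) (≈-trans (from-cong eq) (strictlyInverseʳ y))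

  from-injective : ∀ {i j} → from i ≈ from j → i ≡ j
  from-injective {i} {j} eq =
    trans (sym (strictlyInverseˡ i)) (trans (to-cong eq) (strictlyInverseˡ j))

  infix 4 _≈?_
  _≈?_ : Decidable₂ _≈_
  x ≈? y = map′ to-injective to-cong (to x ≟ to y)

  -- Only the representatives `from i` are tried; `resp` moves an arbitrary witness to the
  -- representative of its class.
  search : {P : Pred Carrier p} → (∀ {x y} → x ≈ y → P x → P y) → Decidable P → Dec (∃ P)
  search resp P? = map′ (λ (i , h) → from i , h)
    (λ (x , h) → to x , resp (≈-sym (strictlyInverseʳ x)) h) (any? (P? ∘ from))

  check : {P : Pred Carrier p} → (∀ {x y} → x ≈ y → P x → P y) → Decidable P → Dec (∀ x → P x)
  check resp P? = map′ (λ h x → resp (strictlyInverseʳ x) (h (to x))) (_∘ from) (all? (P? ∘ from))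

  -- The inverse laws are asked only up to pointwise equality, so coding functions by base-`N`
  -- digits suffices. Applied twice, this enumerates families of vectors.
  vectors : ∀ k → Enumeration (≋-setoid S k) (N ^ k)
  vectors k = record
    { to        = λ v → funToFin (to ∘ v)
    ; from      = λ i j → from (finToFun i j)
    ; to-cong   = λ eq → funToFin-cong (λ i → to-cong (eq i))
    ; from-cong = λ { refl _ → ≈-refl }
    ; inverse   =
        (λ {i} eq → trans (funToFin-cong (λ j → inverseˡ (eq j))) (funToFin-finToFin {k} {N} i))
      , (λ { {v} refl j → inverseʳ (finToFun-funToFin (to ∘ v) j) })
    }

module _ {S : Setoid a ℓ₁} {T : Setoid b ℓ₂} (I : Enumeration S m) (J : Enumeration T n) where
  private
    module S = Setoid S
    module T = Setoid T

  injection⇒≤ : (f : S.Carrier → T.Carrier) → (∀ {x y} → f x T.≈ f y → x S.≈ y) → m ≤ n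
  injection⇒≤ f f-inj = injective⇒≤ {f = Inverse.to J ∘ f ∘ Inverse.from I}
    (λ eq → from-injective I (f-inj (to-injective J eq)))

-- Colourings of finite graphs

-- If all `suc D` colours occurred on `P`, choosing one index per colour would give `suc D` labels
-- in `Fin D`. Two distinct colours would then share a label, hence an index, which has only one
-- colour.
free-colour : {P : Pred (Fin N) p} → Decidable P →
  (label : ∀ {j} → P j → Fin D) → (∀ {i j} (x : P i) (y : P j) → label x ≡ label y → i ≡ j) →
  (f : Fin N → Fin (suc D)) → ∃ λ c → ∀ {j} → P j → c ≢ f j
free-colour {P = P} P? label label-inj f
  with all? (λ c → any? (λ j → P? j ×-dec (f j ≟ c)))
... | yes used =
  let c , c′ , c<c′ , eq = pigeonhole (ℕ.n<1+n _) (λ c → label (proj₁ (proj₂ (used c))))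
      j≡j′ = label-inj (proj₁ (proj₂ (used c))) (proj₁ (proj₂ (used c′))) eq
  in contradiction
       (trans (sym (proj₂ (proj₂ (used c)))) (trans (cong f j≡j′) (proj₂ (proj₂ (used c′)))))
       (<⇒≢ c<c′)
... | no ¬used =
  let c , ¬c = ¬∀⟶∃¬ _ _ (λ c → any? (λ j → P? j ×-dec (f j ≟ c))) ¬used
  in c , λ Pj c≡fj → ¬c (_ , Pj , sym c≡fj)

-- Vertex `zero` is coloured after all the others, avoiding the colours of its at most `D`
-- neighbours. Stating the degree bound as an injective labelling lets it restrict to the smaller
-- graph without any counting.
greedy : (E : Rel (Fin N) r) → Symmetric E → (∀ {i} → ¬ E i i) → Decidable₂ E →
  (label : ∀ {i j} → E i j → Fin D) →
  (∀ {i j k} (x : E i j) (y : E i k) → label x ≡ label y → j ≡ k) →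
  ∃ λ (f : Fin N → Fin (suc D)) → ∀ i j → E i j → f i ≢ f j
greedy {N = zero}  E E-sym irr E? label label-inj = (λ ()) , λ ()
greedy {N = suc N} E E-sym irr E? label label-inj =
  let f , f-proper = greedy (λ i j → E (suc i) (suc j)) E-sym irr (λ i j → E? (suc i) (suc j))
                       label (λ x y eq → suc-inj (label-inj x y eq))
      c , c-free   = free-colour (λ j → E? zero (suc j)) label
                       (λ x y eq → suc-inj (label-inj x y eq)) f
  in c Vector.∷ f , λ where
       zero    zero    z≁z → contradiction z≁z irr
       zero    (suc j) z~j → c-free z~j
       (suc i) zero    i~z → c-free (E-sym i~z) ∘ sym
       (suc i) (suc j) i~j → f-proper i j i~j
  where
  suc-inj : ∀ {i j : Fin N} → Fin.suc i ≡ suc j → i ≡ j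
  suc-inj refl = refl

-- Indices outside the image of `index` may be sent to any vertex, so not every code has to describe
-- one.
record FinitelyManyVertices (G : Graph v e r) : Set (v ⊔ e) where
  open Graph G
  field
    {size}     : ℕ
    index      : Vertex → Fin size
    index-cong : ∀ {x y} → x ≈ y → index x ≡ index y
    vertex     : Fin size → Vertex
    vertex-index : ∀ x → vertex (index x) ≈ x

module _ {G : Graph v e r} (fin : FinitelyManyVertices G)
         (adj? : Decidable₂ (Graph.Adjacent G)) where
  open Graph G
  open FinitelyManyVertices fin
  private
    module V = Setoid vertices

  adj-index : ∀ {x y} → Adjacent x y → Adjacent (vertex (index x)) (vertex (index y))
  adj-index {x} {y} xy =
    proj₁ adj-resp-≈ (V.sym (vertex-index y)) (proj₂ adj-resp-≈ (V.sym (vertex-index x)) xy)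

  -- A proper colouring restricts along `vertex` to a function on `Fin size`, and such a function
  -- pulls back along `index`; there are only `k ^ size` functions to test.
  colourable? : ∀ k → Dec (ProperColouring G k)
  colourable? k = map′
    (λ (f , f-proper) → record
      { colour = f ∘ index
      ; cong   = λ x≈y → cong f (index-cong x≈y)
      ; proper = λ xy → f-proper _ _ (adj-index xy)
      })
    (λ C → let open ProperColouring C in colour ∘ vertex , λ i j → proper)
    (search (vectors ≡-enum size)
      (λ f≗g f-proper i j ij eq → f-proper i j ij (trans (f≗g i) (trans eq (sym (f≗g j)))))
      (λ f → all? λ i → all? λ j → adj? (vertex i) (vertex j) →-dec ¬? (f i ≟ f j)))
    where
    ≡-enum : Enumeration (≡.setoid (Fin k)) k
    ≡-enum = record { to = λ i → i ; from = λ i → i ; to-cong = λ eq → eq ; from-cong = λ eq → eq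
                    ; inverse = (λ eq → eq) , (λ eq → eq) }

  -- Only the chosen representative of each ≈-class is coloured greedily: the
  -- enumeration may list a class several times, but a label pins down only the class.
  degree-bound⇒colourable : (label : ∀ {x y} → Adjacent x y → Fin D) →
    (∀ {x y z} (xy : Adjacent x y) (xz : Adjacent x z) → label xy ≡ label xz → y ≈ z) →
    ProperColouring G (suc D)
  degree-bound⇒colourable {D} label label-inj =
    let f , f-proper = greedy E E-sym E-irrefl E? (label ∘ proj₁) E-label-inj
    in record
      { colour = f ∘ index
      ; cong   = λ x≈y → cong f (index-cong x≈y)
      ; proper = λ xy → f-proper _ _ (adj-index xy , canonical _ , canonical _)
      }
    where
    Canonical : Pred (Fin size) _
    Canonical i = index (vertex i) ≡ i

    canonical : ∀ x → Canonical (index x)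
    canonical x = index-cong (vertex-index x)

    E : Rel (Fin size) r
    E i j = Adjacent (vertex i) (vertex j) × Canonical i × Canonical j

    E-sym : Symmetric E
    E-sym (ij , ci , cj) = adj-sym ij , cj , ci

    E-irrefl : ∀ {i} → ¬ E i i
    E-irrefl (ii , _) = adj-irrefl V.refl ii

    E? : Decidable₂ E
    E? i j = adj? (vertex i) (vertex j) ×-dec (index (vertex i) ≟ i) ×-dec (index (vertex j) ≟ j)

    E-label-inj : ∀ {i j k} (x : E i j) (y : E i k) → label (proj₁ x) ≡ label (proj₁ y) → j ≡ k
    E-label-inj (ij , _ , cj) (ik , _ , ck) eq =
      trans (sym cj) (trans (index-cong (label-inj ij ik eq)) ck)

  chromatic-number : ProperColouring G k → ∃ λ χ → IsChromaticNumber G χ × χ ≤ k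
  chromatic-number {k} C =
    let χ , Cχ , min , χ≤k = least colourable? k C in χ , (Cχ , min) , χ≤k

-- Linear algebra over a finite field

module FiniteField {F : HeytingField c ℓ₁ ℓ₂} {q : ℕ} (order : HasOrder F q) (2≤q : 2 ≤ q) where
  open HeytingField F using (_#_; tight; #⇒invertible)
  open CommutativeRing
    (HeytingCommutativeRing.commutativeRing (HeytingField.heytingCommutativeRing F))
    using (Carrier; _≈_; 0#; 1#; -_; setoid; +-cong; *-cong; *-congˡ; +-congˡ; +-congʳ; *-congʳ;
           +-identityˡ; +-identityʳ; *-identityˡ; *-assoc; +-assoc; +-comm; zeroˡ; -‿inverseʳ;
           ring; semiring; +-group; -‿cong; distribʳ)
    renaming (_+_ to _⊕_; _*_ to _⊗_; sym to ≈-sym; trans to ≈-trans)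
  open import Algebra.Properties.Semiring.Sum semiring using (sum-cong-≋; ∑-distrib-+; *-distribˡ-sum)
  open import Algebra.Properties.Ring ring using (-‿distribˡ-*; -‿distribʳ-*; -0#≈0#)
  open import Algebra.Properties.Group +-group using (inverseˡ-unique; ⁻¹-involutive)
  open LinearAlgebra F
  import Relation.Binary.Reasoning.Setoid setoid as ≈-Reasoning

  module V {n} = Setoid (≋-setoid setoid n)

  Vec-enum : ∀ n → Enumeration (≋-setoid setoid n) (q ^ n)
  Vec-enum = vectors order

  Family-setoid : ℕ → ℕ → Setoid c ℓ₁
  Family-setoid n d = ≋-setoid (≋-setoid setoid n) d

  Family-enum : ∀ n d → Enumeration (Family-setoid n d) ((q ^ n) ^ d)
  Family-enum n = vectors (Vec-enum n)

  _≋?_ : Decidable₂ (_≋_ {n})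
  _≋?_ {n} = _≈?_ (Vec-enum n)

  -- Passes from denial of equality to invertibility: if the search finds no inverse, `x` is not
  -- apart from `0#`, and tightness forces `x ≈ 0#`. The inverse supplied by apartness is one of
  -- `x - 0#`, hence the rewriting.
  nonzero⇒unit : ∀ x → ¬ x ≈ 0# → ∃ λ y → y ⊗ x ≈ 1#
  nonzero⇒unit x x≉0 with search order {P = λ y → y ⊗ x ≈ 1#} (λ y≈z eq → ≈-trans (*-congʳ (≈-sym y≈z)) eq)
                         (λ y → _≈?_ order (y ⊗ x) 1#)
  ... | yes inv = inv
  ... | no ¬inv = contradiction (proj₁ (tight x 0#) ¬x#0) x≉0
    where
    ¬x#0 : ¬ x # 0#
    ¬x#0 x#0 = let y , yx≈1 , _ = #⇒invertible x#0 in
      ¬inv (y , ≈-trans (*-congˡ (≈-sym (≈-trans (+-congˡ -0#≈0#) (+-identityʳ x)))) yx≈1)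

  -- Linear combinations, spans and independence.

  combination-cong : ∀ {n d} {a a′ : Vec d} {b b′ : Vector (Vec n) d} →
    a ≋ a′ → (∀ i → b i ≋ b′ i) → combination a b ≋ combination a′ b′
  combination-cong a≋a′ b≋b′ j = sum-cong-≋ λ i → *-cong (a≋a′ i) (b≋b′ i j)

  combination-⊞ : ∀ {n d} (a a′ : Vec d) (b : Vector (Vec n) d) →
    combination (a ⊞ a′) b ≋ combination a b ⊞ combination a′ b
  combination-⊞ a a′ b j = ≈-trans
    (sum-cong-≋ λ i → distribʳ (b i j) (a i) (a′ i))
    (∑-distrib-+ (λ i → a i ⊗ b i j) (λ i → a′ i ⊗ b i j))

  combination-⊡ : ∀ {n d} x (a : Vec d) (b : Vector (Vec n) d) →
    combination (x ⊡ a) b ≋ x ⊡ combination a b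
  combination-⊡ x a b j = ≈-trans
    (sum-cong-≋ λ i → *-assoc x (a i) (b i j))
    (≈-sym (*-distribˡ-sum x (λ i → a i ⊗ b i j)))

  combination-𝟎 : ∀ {n d} (b : Vector (Vec n) d) → combination 𝟎 b ≋ 𝟎
  combination-𝟎 {d = d} b j = ≈-trans
    (combination-cong {a = 𝟎} {b = b} (λ i → ≈-sym (zeroˡ 0#)) (λ i → V.refl) j)
    (≈-trans (combination-⊡ 0# 𝟎 b j) (zeroˡ (combination 𝟎 b j)))

  combination-closed : ∀ {n d} (W : Subspace n) (a : Vec d) {b : Vector (Vec n) d} →
    (∀ i → b i ∈ member W) → combination a b ∈ member W
  combination-closed {d = zero}  W a b∈W = 𝟎-closed W
  combination-closed {d = suc d} W a b∈W =
    ⊞-closed W (⊡-closed W (a zero) (b∈W zero))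
               (combination-closed W (a ∘ suc) (b∈W ∘ suc))

  span : ∀ {n d} → Vector (Vec n) d → Subspace n
  span b = record
    { member   = λ v → ∃ λ a → v ≋ combination a b
    ; resp-≋   = λ v≋w (a , eq) → a , V.trans (V.sym v≋w) eq
    ; 𝟎-closed = 𝟎 , V.sym (combination-𝟎 b)
    ; ⊞-closed = λ (a , eq) (a′ , eq′) → a ⊞ a′ ,
        λ j → ≈-trans (+-cong (eq j) (eq′ j)) (≈-sym (combination-⊞ a a′ b j))
    ; ⊡-closed = λ x (a , eq) → x ⊡ a ,
        λ j → ≈-trans (*-congˡ (eq j)) (≈-sym (combination-⊡ x a b j))
    }

  member-span : ∀ {n d} (b : Vector (Vec n) d) i → b i ∈ member (span b)
  member-span {d = suc d} b zero    = 1# Vector.∷ 𝟎 , λ j → ≈-sym (≈-trans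
    (+-cong (*-identityˡ _) (combination-𝟎 (b ∘ suc) j)) (+-identityʳ _))
  member-span {d = suc d} b (suc i) = let a , eq = member-span (b ∘ suc) i in
    0# Vector.∷ a , λ j → ≈-trans (eq j) (≈-sym (≈-trans (+-congʳ (zeroˡ _)) (+-identityˡ _)))

  span? : ∀ {n d} (b : Vector (Vec n) d) → Decidable (member (span b))
  span? {n} {d} b v = search (Vec-enum d)
    (λ a≋a′ eq → V.trans eq (combination-cong a≋a′ (λ i → V.refl)))
    (λ a → v ≋? combination a b)

  independent? : ∀ {n d} (b : Vector (Vec n) d) → Dec (LinearlyIndependent b)
  independent? {n} {d} b = check (Vec-enum d)
    (λ a≋a′ h eq → V.trans (V.sym a≋a′)
      (h (V.trans (combination-cong a≋a′ (λ i → V.refl)) eq)))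
    (λ a → (combination a b ≋? 𝟎) →-dec (a ≋? 𝟎))

  independent-resp : ∀ {n d} {b b′ : Vector (Vec n) d} → (∀ i → b i ≋ b′ i) →
    LinearlyIndependent b → LinearlyIndependent b′
  independent-resp b≋b′ ind a eq = ind a (V.trans (combination-cong {a = a} V.refl b≋b′) eq)

  combination-injective : ∀ {n d} {b : Vector (Vec n) d} → LinearlyIndependent b →
    ∀ {a a′} → combination a b ≋ combination a′ b → a ≋ a′
  combination-injective {b = b} ind {a} {a′} eq i = begin
    a i                     ≈⟨ inverseˡ-unique _ _ (difference i) ⟩
    - ((- 1#) ⊗ a′ i)       ≈⟨ -‿cong (-‿distribˡ-* 1# (a′ i)) ⟨
    - (- (1# ⊗ a′ i))       ≈⟨ ⁻¹-involutive _ ⟩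
    1# ⊗ a′ i               ≈⟨ *-identityˡ _ ⟩
    a′ i                    ∎
    where
    open ≈-Reasoning
    -- Subtraction is written with the scalar `- 1#` so that additivity and homogeneity of
    -- `combination` apply.
    difference : a ⊞ (- 1#) ⊡ a′ ≋ 𝟎
    difference = ind (a ⊞ (- 1#) ⊡ a′) λ j → begin
      combination (a ⊞ (- 1#) ⊡ a′) b j
        ≈⟨ combination-⊞ a ((- 1#) ⊡ a′) b j ⟩
      combination a b j ⊕ combination ((- 1#) ⊡ a′) b j
        ≈⟨ +-cong (eq j) (combination-⊡ (- 1#) a′ b j) ⟩
      combination a′ b j ⊕ (- 1#) ⊗ combination a′ b j
        ≈⟨ +-congˡ (-‿distribˡ-* 1# _) ⟨
      combination a′ b j ⊕ - (1# ⊗ combination a′ b j)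
        ≈⟨ +-congˡ (-‿cong (*-identityˡ _)) ⟩
      combination a′ b j ⊕ - combination a′ b j
        ≈⟨ -‿inverseʳ _ ⟩
      0# ∎

  -- In a vanishing combination, either the coefficient of `v` is zero and the relation concerns `w`
  -- alone, or dividing by it puts `v` in the span of `w`.
  independent-∷ : ∀ {n d} {w : Vector (Vec n) d} {v : Vec n} → LinearlyIndependent w →
    v ∉ member (span w) → LinearlyIndependent (v Vector.∷ w)
  independent-∷ {w = w} {v} ind v∉w a eq with _≈?_ order (a zero) 0#
  ... | yes a₀≈0 = λ { zero → a₀≈0 ; (suc i) → ind (a ∘ suc) tail≋0 i }
    where
    tail≋0 : combination (a ∘ suc) w ≋ 𝟎
    tail≋0 j = ≈-trans (≈-sym (≈-trans (+-congʳ (≈-trans (*-congʳ a₀≈0) (zeroˡ _))) (+-identityˡ _))) (eq j)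
  ... | no a₀≉0 = contradiction ((- y) ⊡ (a ∘ suc) , v≋) v∉w
    where
    open ≈-Reasoning
    y = proj₁ (nonzero⇒unit (a zero) a₀≉0)
    v≋ : v ≋ combination ((- y) ⊡ (a ∘ suc)) w
    v≋ j = begin
      v j                                   ≈⟨ *-identityˡ _ ⟨
      1# ⊗ v j                              ≈⟨ *-congʳ (proj₂ (nonzero⇒unit (a zero) a₀≉0)) ⟨
      (y ⊗ a zero) ⊗ v j                    ≈⟨ *-assoc _ _ _ ⟩
      y ⊗ (a zero ⊗ v j)                    ≈⟨ *-congˡ (inverseˡ-unique _ _ (eq j)) ⟩
      y ⊗ - combination (a ∘ suc) w j       ≈⟨ -‿distribʳ-* _ _ ⟨
      - (y ⊗ combination (a ∘ suc) w j)     ≈⟨ -‿distribˡ-* _ _ ⟩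
      (- y) ⊗ combination (a ∘ suc) w j     ≈⟨ combination-⊡ (- y) (a ∘ suc) w j ⟨
      combination ((- y) ⊡ (a ∘ suc)) w j   ∎

  independent-tail : ∀ {n d} {w : Vector (Vec n) (suc d)} →
    LinearlyIndependent w → LinearlyIndependent (w ∘ suc)
  independent-tail {w = w} ind a eq i = ind (0# Vector.∷ a)
    (λ j → ≈-trans (+-congʳ (zeroˡ _)) (≈-trans (+-identityˡ _) (eq j))) (suc i)

  -- Dimension bounds by counting.

  ^-cancel-≤ : ∀ k m → q ^ k ≤ q ^ m → k ≤ m
  ^-cancel-≤ k m qᵏ≤qᵐ = ℕ.≮⇒≥ λ m<k → ℕ.<⇒≱ (ℕ.^-monoʳ-< q 2≤q m<k) qᵏ≤qᵐ

  -- Counting replaces the exchange lemma: an injection gives `q ^ k ≤ q ^ m`, and `2 ≤ q` allows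
  -- the exponents to be compared.
  injection⇒dim-≤ : (f : Vec k → Vec m) → (∀ {a a′} → f a ≋ f a′ → a ≋ a′) → k ≤ m
  injection⇒dim-≤ {k} {m} f f-inj = ^-cancel-≤ k m (injection⇒≤ (Vec-enum k) (Vec-enum m) f f-inj)

  independent⇒≤n : ∀ {n d} {w : Vector (Vec n) d} → LinearlyIndependent w → d ≤ n
  independent⇒≤n {w = w} ind = injection⇒dim-≤ (λ a → combination a w) (combination-injective ind)

  -- Send `a` to the coordinates of `combination a w` in the basis of `W`. Coordinates determine the
  -- vector, and independence of `w` recovers `a` from it.
  independent⇒≤dim : ∀ {n k m} {W : Subspace n} → HasDim W m → {w : Vector (Vec n) k} →
    LinearlyIndependent w → (∀ i → w i ∈ member W) → k ≤ m
  independent⇒≤dim {W = W} (b , B) {w} ind w∈W =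
    injection⇒dim-≤ (λ a → proj₁ (coords a)) λ {a} {a′} eq → combination-injective ind
      (V.trans (proj₂ (coords a))
        (V.trans (combination-cong {b = b} eq (λ i → V.refl)) (V.sym (proj₂ (coords a′)))))
    where
    coords : ∀ a → combination a w ∈ member (span b)
    coords a = IsBasis.spanning B (combination-closed W a w∈W)

  member? : ∀ {n d} {W : Subspace n} → HasDim W d → Decidable (member W)
  member? {W = W} (b , B) v = map′
    (λ (a , eq) → resp-≋ W (V.sym eq) (combination-closed W a inside)) spanning (span? b v)
    where open IsBasis B

  -- Subfamilies and completions of independent families.

  shrink : ∀ {n d t} {W : Subspace n} → t ≤ d → HasDim W d →
    ∃ λ (w : Vector (Vec n) t) → LinearlyIndependent w × (∀ i → w i ∈ member W)
  shrink {W = W} t≤d (b , B) = go {W = W} (ℕ.≤⇒≤′ t≤d) (IsBasis.independent B) (IsBasis.inside B)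
    where
    go : ∀ {n d t} {W : Subspace n} {w : Vector (Vec n) d} → t ≤′ d → LinearlyIndependent w →
      (∀ i → w i ∈ member W) →
      ∃ λ (w : Vector (Vec n) t) → LinearlyIndependent w × (∀ i → w i ∈ member W)
    go (≤′-reflexive refl) ind w∈W = _ , ind , w∈W
    -- Each `≤′-step` drops the first vector of the family.
    go {W = W} {w} (≤′-step t≤d) ind w∈W =
      go {W = W} t≤d (independent-tail {w = w} ind) (w∈W ∘ suc)

  Spans : ∀ {n k r} (W : Subspace n) (w : Vector (Vec n) k) (z : Vector (Vec n) r) → Set (c ⊔ ℓ₁)
  Spans W w z = ∀ {v} → v ∈ member W → ∃₂ λ a a′ → v ≋ combination a w ⊞ combination a′ z

  -- The z are allowed to be redundant (padded by 𝟎), so that r is exactly m − k.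
  extend : ∀ {n m} {W : Subspace n} → HasDim W m → ∀ r {k} → k + r ≡ m →
    {w : Vector (Vec n) k} → LinearlyIndependent w → (∀ i → w i ∈ member W) →
    ∃ λ (z : Vector (Vec n) r) → (∀ i → z i ∈ member W) × Spans W w z
  extend {n} {W = W} dimW r {k} k+r≡m {w} ind w∈W
    with search (Vec-enum n) {P = λ v → v ∈ member W × v ∉ member (span w)}
           (λ v≋v′ (v∈W , v∉w) → resp-≋ W v≋v′ v∈W , v∉w ∘ resp-≋ (span w) (V.sym v≋v′))
           (λ v → member? {W = W} dimW v ×-dec ¬? (span? w v))
  -- No vector of `W` lies outside the span of `w`, so zeros fill the remaining places.
  ... | no full = (λ _ → 𝟎) , (λ _ → 𝟎-closed W) , spans
    where
    spans : Spans W w (λ _ → 𝟎)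
    spans {v} v∈W with span? w v
    ... | yes (a , eq) = a , 𝟎 , λ j → ≈-trans (eq j)
      (≈-sym (≈-trans (+-congˡ (combination-𝟎 {d = r} (λ _ → 𝟎) j)) (+-identityʳ _)))
    ... | no v∉w = contradiction (v , v∈W , v∉w) full
  -- Here `k` is already the dimension, and `v` would give `suc k` independent vectors in `W`.
  extend {W = W} dimW zero {k} k+0≡m {w} ind w∈W | yes (v , v∈W , v∉w) =
    contradiction
      (subst (suc k ≤_) (trans (sym k+0≡m) (ℕ.+-identityʳ k))
        (independent⇒≤dim {W = W} dimW {v Vector.∷ w} (independent-∷ {w = w} ind v∉w)
          λ { zero → v∈W ; (suc i) → w∈W i }))
      (ℕ.<-irrefl refl)
  extend {W = W} dimW (suc r) {k} k+1+r≡m {w} ind w∈W | yes (v , v∈W , v∉w) =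
    let z , z∈W , spans = extend {W = W} dimW r (trans (sym (ℕ.+-suc k r)) k+1+r≡m)
                            {v Vector.∷ w} (independent-∷ {w = w} ind v∉w) λ { zero → v∈W ; (suc i) → w∈W i }
    -- The recursive call counts `v` among the independent vectors; its coefficient `a zero` now
    -- moves to the side of `z`.
    in v Vector.∷ z , (λ { zero → v∈W ; (suc i) → z∈W i }) , λ u∈W →
       let a , a′ , eq = spans u∈W in
       a ∘ suc , a zero Vector.∷ a′ , λ j → ≈-trans (eq j)
         (≈-trans (+-congʳ (+-comm _ _)) (+-assoc _ _ _))

  -- A basis is sought among the `(q ^ n) ^ d` families, and spanning is tested on all `q ^ n`
  -- vectors.
  HasDim? : ∀ {n} (W : Subspace n) → Decidable (member W) → ∀ d → Dec (HasDim W d)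
  HasDim? {n} W W? d = search (Family-enum n d)
    (λ b≋b′ B → let open IsBasis B in record
      { inside      = λ i → resp-≋ W (b≋b′ i) (inside i)
      ; independent = independent-resp b≋b′ independent
      ; spanning    = λ v∈W → let a , eq = spanning v∈W in
          a , V.trans eq (combination-cong {a = a} V.refl b≋b′)
      })
    (λ b → map′
      (λ (inside , independent , spanning) → record
        { inside = inside ; independent = independent ; spanning = λ {v} → spanning v })
      (λ B → let open IsBasis B in inside , independent , λ v → spanning)
      (all? (W? ∘ b) ×-dec independent? b ×-dec
        check (Vec-enum n)
          (λ v≋v′ h v′∈W → resp-≋ (span b) v≋v′ (h (resp-≋ W (V.sym v≋v′) v′∈W)))
          (λ v → W? v →-dec span? b v)))

  -- Finiteness of the vertex set and decidability of adjacency.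

  module _ (n m t : ℕ) where
    open Setoid (Grassmannian n m) using () renaming (Carrier to Vertex; _≈_ to _≃_)

    ∋? : (x : Vertex) → Decidable (member (proj₁ x))
    ∋? (U , dimU) = member? {W = U} dimU

    bit : Bool → Fin 2
    bit = Inverse.from 2↔Bool

    -- A subspace is encoded by its characteristic function, which unlike a basis
    -- depends only on the ≈-class of the vertex.
    bits : Vertex → Fin (q ^ n) → Fin 2
    bits x i = bit (does (∋? x (Inverse.from (Vec-enum n) i)))

    vertexIndex : Vertex → Fin (2 ^ (q ^ n))
    vertexIndex x = funToFin (bits x)

    vertexIndex-cong : ∀ {x y} → x ≃ y → vertexIndex x ≡ vertexIndex y
    vertexIndex-cong {x} {y} (U⊆V , V⊆U) = funToFin-cong {f = bits x} {bits y} λ i →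
      cong bit (does-⇔ (mk⇔ U⊆V V⊆U) (∋? x _) (∋? y _))

    vertexIndex-⊆ : ∀ {x y} → vertexIndex x ≡ vertexIndex y → member (proj₁ x) ⊆ member (proj₁ y)
    vertexIndex-⊆ {x} {y} eq {v} v∈x =
      resp-≋ (proj₁ y) (strictlyInverseʳ v)
        (does-≡⇒ (∋? x _) (∋? y _)
          (≡bit (funToFin-injective (bits x) (bits y) eq (to v)))
          (resp-≋ (proj₁ x) (V.sym (strictlyInverseʳ v)) v∈x))
      where
      open Inverse (Vec-enum n)
      ≡bit : ∀ {a b} → bit a ≡ bit b → a ≡ b
      ≡bit {a} {b} eq = trans (sym (Inverse.strictlyInverseˡ 2↔Bool a))
        (trans (cong (Inverse.to 2↔Bool) eq) (Inverse.strictlyInverseˡ 2↔Bool b))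

    vertexIndex-injective : ∀ {x y} → vertexIndex x ≡ vertexIndex y → x ≃ y
    vertexIndex-injective {x} {y} eq = vertexIndex-⊆ {x} {y} eq , vertexIndex-⊆ {y} {x} (sym eq)

    ≃? : Decidable₂ _≃_
    ≃? x y = map′ (vertexIndex-injective {x} {y}) (vertexIndex-cong {x} {y}) (vertexIndex x ≟ vertexIndex y)

    spanVertex : (b : Vector (Vec n) m) → LinearlyIndependent b → Vertex
    spanVertex b ind = span b , b , record
      { inside = member-span b ; independent = ind ; spanning = λ v∈b → v∈b }

    spanVertex-cong : ∀ {b b′ : Vector (Vec n) m} → (∀ i → b i ≋ b′ i) →
      (ind : LinearlyIndependent b) (ind′ : LinearlyIndependent b′) →
      spanVertex b ind ≃ spanVertex b′ ind′
    spanVertex-cong b≋b′ ind ind′ =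
      (λ (a , eq) → a , V.trans eq (combination-cong {a = a} V.refl b≋b′)) ,
      (λ (a , eq) → a , V.trans eq (combination-cong {a = a} V.refl (λ i → V.sym (b≋b′ i))))

    spanVertex-basis : ∀ x → spanVertex (proj₁ (proj₂ x)) (IsBasis.independent (proj₂ (proj₂ x))) ≃ x
    spanVertex-basis (U , b , B) =
      (λ (a , eq) → resp-≋ U (V.sym eq) (combination-closed U a inside)) , spanning
      where open IsBasis B

    -- Decodes an index through bases: families of vectors can be searched exhaustively, arbitrary
    -- membership predicates cannot.
    Represents : Fin (2 ^ (q ^ n)) → Vector (Vec n) m → Set (c ⊔ ℓ₁)
    Represents i b = Σ (LinearlyIndependent b) λ ind → vertexIndex (spanVertex b ind) ≡ i

    represents? : ∀ i → Decidable (Represents i)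
    represents? i b with independent? b
    ... | no ¬ind = no (¬ind ∘ proj₁)
    ... | yes ind = map′ (ind ,_)
      (λ (ind′ , eq) → trans (vertexIndex-cong {spanVertex b ind} {spanVertex b ind′}
                                (spanVertex-cong (λ i → V.refl) ind ind′)) eq)
      (vertexIndex (spanVertex b ind) ≟ i)

    represents-resp : ∀ {i b b′} → (∀ j → b j ≋ b′ j) → Represents i b → Represents i b′
    represents-resp b≋b′ (ind , eq) = independent-resp b≋b′ ind ,
      trans (sym (vertexIndex-cong {spanVertex _ ind} {spanVertex _ (independent-resp b≋b′ ind)}
                   (spanVertex-cong b≋b′ ind (independent-resp b≋b′ ind)))) eq

    finitelyManyVertices : FinitelyManyVertices (J F n m t)
    finitelyManyVertices with search (Family-enum n m) independent-resp independent?
    -- Without independent families of length `m` there are no vertices; this covers `m > n`.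
    ... | no none = record
      { size         = 0
      ; index        = λ x → noVertex x
      ; index-cong   = λ {x} → noVertex x
      ; vertex       = λ ()
      ; vertex-index = λ x → noVertex x
      }
      where
      noVertex : ∀ {a} {A : Set a} → Vertex → A
      noVertex (U , b , B) = contradiction (b , IsBasis.independent B) none
    ... | yes (b₀ , ind₀) = record
      { index        = vertexIndex
      ; index-cong   = λ {x} {y} → vertexIndex-cong {x} {y}
      ; vertex       = λ i → vertex (find i)
      ; vertex-index = vertex-index
      }
      where
      find : ∀ i → Dec (∃ (Represents i))
      find i = search (Family-enum n m) represents-resp (represents? i)

      vertex : ∀ {i} → Dec (∃ (Represents i)) → Vertex
      vertex (yes (b , ind , _)) = spanVertex b ind
      -- Default value for codes that belong to no `m`-dimensional subspace.
      vertex (no _)              = spanVertex b₀ ind₀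

      vertex-index : ∀ x → vertex (find (vertexIndex x)) ≃ x
      vertex-index x@(U , b , B) with find (vertexIndex x)
      ... | yes (b′ , ind , eq) = vertexIndex-injective {spanVertex b′ ind} {x} eq
      ... | no ¬rep = contradiction (b , IsBasis.independent B ,
        vertexIndex-cong {spanVertex b (IsBasis.independent B)} {x} (spanVertex-basis x)) ¬rep

    adjacent? : Decidable₂ (Graph.Adjacent (J F n m t))
    adjacent? x@(U , dimU) y@(V , dimV) = ¬? (≃? x y) ×-dec map′
      (λ (d , d<1+n , t≤d , D) → d , t≤d , D)
      -- A basis of the intersection is independent in `n`-space, so `d ≤ n` and the search over `d`
      -- is finite.
      (λ (d , t≤d , D) → d , s≤s (independent⇒≤n (IsBasis.independent (proj₂ D))) , t≤d , D)
      (ℕ.anyUpTo? (λ d → (t ℕ.≤? d) ×-dec HasDim? (U ⊓ V) (λ v → ∋? x v ×-dec ∋? y v) d) (suc n))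

    -- Labelling the neighbours of a vertex.

    module _ {s : ℕ} (t+s≡m : t + s ≡ m) where
      -- The first `t` generators are recorded by coordinates in the basis `b`, so `A` has
      -- `(q ^ m) ^ t` possible values, a number free of `n`.
      Generates : Vertex → Vector (Vec m) t → Vector (Vec n) s → Vertex → Set (c ⊔ ℓ₁)
      Generates (U , b , _) A z (V , _) =
        (∀ i → combination (A i) b ∈ member V) × (∀ i → z i ∈ member V) ×
        Spans V (λ i → combination (A i) b) z

      neighbour-data : ∀ {x y} → Graph.Adjacent (J F n m t) x y →
        ∃₂ λ A z → Generates x A z y
      neighbour-data {U , b , B} {V , dimV} (_ , d , t≤d , D) =
        let w , ind , w∈U⊓V = shrink {W = U ⊓ V} t≤d D
            coords = λ i → IsBasis.spanning B (proj₁ (w∈U⊓V i))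
            w≋ = proj₂ ∘ coords
            z , z∈V , spans = extend {W = V} dimV s t+s≡m ind (proj₂ ∘ w∈U⊓V)
        in proj₁ ∘ coords , z ,
           (λ i → resp-≋ V (w≋ i) (proj₂ (w∈U⊓V i))) , z∈V , λ v∈V →
             let a , a′ , eq = spans v∈V in
             a , a′ , λ j → ≈-trans (eq j) (+-congʳ (combination-cong {a = a} V.refl w≋ j))

      -- A subspace containing a generating family of `y` contains `y`. Used in both directions,
      -- this shows that `x`, `A` and `z` determine the neighbour.
      generates-⊆ : ∀ {x y y′ A A′ z z′} → Generates x A z y → Generates x A′ z′ y′ →
        (∀ i → A i ≋ A′ i) → (∀ i → z i ≋ z′ i) → member (proj₁ y) ⊆ member (proj₁ y′)
      generates-⊆ {y′ = V′ , _} (_ , _ , spans) (A′∈V′ , z′∈V′ , _) A≋A′ z≋z′ v∈V =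
        let a , a′ , eq = spans v∈V in
        resp-≋ V′ (V.sym eq) (⊞-closed V′
          (combination-closed V′ a λ i →
            resp-≋ V′ (combination-cong (V.sym (A≋A′ i)) (λ _ → V.refl)) (A′∈V′ i))
          (combination-closed V′ a′ λ i → resp-≋ V′ (V.sym (z≋z′ i)) (z′∈V′ i)))

      label : ∀ {x y} → Graph.Adjacent (J F n m t) x y → Fin (((q ^ m) ^ t) * ((q ^ n) ^ s))
      label {x} {y} xy = let A , z , _ = neighbour-data {x} {y} xy in
        combine (Inverse.to (Family-enum m t) A) (Inverse.to (Family-enum n s) z)

      -- Equal labels give pointwise equal `A` and `z`, whichever generators the two adjacency
      -- proofs led to, and these span the same neighbour.
      label-injective : ∀ {x y y′} (xy : Graph.Adjacent (J F n m t) x y)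
        (xy′ : Graph.Adjacent (J F n m t) x y′) → label {x} {y} xy ≡ label {x} {y′} xy′ → y ≃ y′
      label-injective {x} {y} {y′} xy xy′ eq =
        let A , z , gen    = neighbour-data {x} {y} xy
            A′ , z′ , gen′ = neighbour-data {x} {y′} xy′
            eqA , eqz = combine-injective _ _ _ _ eq
            A≋A′ = to-injective (Family-enum m t) eqA
            z≋z′ = to-injective (Family-enum n s) eqz
        in generates-⊆ {x} {y} {y′} gen gen′ A≋A′ z≋z′ ,
           generates-⊆ {x} {y′} {y} gen′ gen (λ i → V.sym (A≋A′ i)) (λ i → V.sym (z≋z′ i))

      J-chromatic-bound : ∃ λ χ → IsChromaticNumber (J F n m t) χ ×
        χ ≤ suc (((q ^ m) ^ t) * ((q ^ n) ^ s))
      J-chromatic-bound = chromatic-number finitelyManyVertices adjacent?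
        (degree-bound⇒colourable finitelyManyVertices adjacent?
          (λ {x} {y} → label {x} {y}) (λ {x} {y} {y′} → label-injective {x} {y} {y′}))

-- Asymptotics

/-vanishes : ∀ K → TendsToZero (λ n → + K / suc n)
/-vanishes K ε 0<ε = threshold ε 0<ε
  where
  bound : ∀ n a b-1 → K * suc b-1 ≤ n → ℚᵘ.mkℚᵘ (+ K) n ℚᵘ.< ℚᵘ.mkℚᵘ +[1+ a ] b-1
  bound n a b-1 Kb≤n = ℚᵘ.*<* (subst₂ ℤ._<_ (ℤ.pos-* K (suc b-1)) (ℤ.pos-* (suc a) (suc n))
    (ℤ.+<+ (s≤s (ℕ.≤-trans Kb≤n (ℕ.m≤m+n n (a * suc n))))))

  threshold : ∀ ε → 0ℚ ℚ.< ε → ∃ λ N → ∀ n → N ≤ n → ℚ.∣ + K / suc n ∣ ℚ.< ε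
  threshold (ℚ.mkℚ (+ zero)  b-1 _) (ℚ.*<* (ℤ.+<+ ()))
  threshold (ℚ.mkℚ -[1+ a ]  b-1 _) (ℚ.*<* ())
  -- For `ε = (a + 1) / b`, the bound `K b ≤ n` gives `K b < n + 1 ≤ (a + 1)(n + 1)`, which is
  -- `K / (n + 1) < ε` cross-multiplied.
  threshold ε@(ℚ.mkℚ +[1+ a ] b-1 _) _ = K * suc b-1 , λ n Kb≤n →
    subst (ℚ._< ε)
      (sym (ℚ.0≤p⇒∣p∣≡p (ℚ.nonNegative⁻¹ (+ K / suc n) {{ℚ.normalize-nonNeg K (suc n)}})))
      (ℚ.toℚᵘ-cancel-< (ℚᵘ.<-respˡ-≃ (ℚᵘ.≃-sym (ℚ.toℚᵘ-fromℚᵘ (ℚᵘ.mkℚᵘ (+ K) n))) (bound n a b-1 Kb≤n)))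

-- The hypothesis is the conclusion with the denominator `suc n` cleared; over unnormalised
-- rationals the order is cross-multiplication.
≤-scaled : ∀ x y K n → x * suc n ≤ (suc n + K) * y →
  (+ x / 1) ℚ.≤ (1ℚ ℚ.+ (+ K / suc n)) ℚ.* (+ y / 1)
≤-scaled x y K n h = ℚ.toℚᵘ-cancel-≤ (begin
  ℚ.toℚᵘ (+ x / 1)
    ≃⟨ ℚ.toℚᵘ-fromℚᵘ (ℚᵘ.mkℚᵘ (+ x) 0) ⟩
  ℚᵘ.mkℚᵘ (+ x) 0
    ≤⟨ ℚᵘ.*≤* (subst₂ ℤ._≤_ lhs rhs (ℤ.+≤+ h)) ⟩
  (ℚᵘ.1ℚᵘ ℚᵘ.+ ℚᵘ.mkℚᵘ (+ K) n) ℚᵘ.* ℚᵘ.mkℚᵘ (+ y) 0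
    ≃⟨ ℚᵘ.*-cong (ℚᵘ.+-congʳ ℚᵘ.1ℚᵘ (ℚ.toℚᵘ-fromℚᵘ (ℚᵘ.mkℚᵘ (+ K) n))) (ℚ.toℚᵘ-fromℚᵘ (ℚᵘ.mkℚᵘ (+ y) 0)) ⟨
  (ℚᵘ.1ℚᵘ ℚᵘ.+ ℚ.toℚᵘ (+ K / suc n)) ℚᵘ.* ℚ.toℚᵘ (+ y / 1)
    ≃⟨ ℚᵘ.*-congʳ (ℚ.toℚᵘ-homo-+ 1ℚ (+ K / suc n)) ⟨
  ℚ.toℚᵘ (1ℚ ℚ.+ (+ K / suc n)) ℚᵘ.* ℚ.toℚᵘ (+ y / 1)
    ≃⟨ ℚ.toℚᵘ-homo-* (1ℚ ℚ.+ (+ K / suc n)) (+ y / 1) ⟨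
  ℚ.toℚᵘ ((1ℚ ℚ.+ (+ K / suc n)) ℚ.* (+ y / 1)) ∎)
  where
  open ℚᵘ.≤-Reasoning
  -- `suc ((n + 0) * 1)` is the form in which unnormalised arithmetic computes the denominator of
  -- the product.
  lhs : + (x * suc n) ≡ + x ℤ.* + suc ((n + 0) * 1)
  lhs = trans (cong (λ z → + (x * suc z)) (sym (trans (ℕ.*-identityʳ (n + 0)) (ℕ.+-identityʳ n))))
          (ℤ.pos-* x (suc ((n + 0) * 1)))
  rhs : + ((suc n + K) * y) ≡ ((+ 1 ℤ.* + suc n ℤ.+ + K ℤ.* + 1) ℤ.* + y) ℤ.* + 1
  rhs = sym (trans (ℤ.*-identityʳ _) (trans
    (cong (ℤ._* + y) (cong₂ ℤ._+_ (ℤ.*-identityˡ (+ suc n)) (ℤ.*-identityʳ (+ K))))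
    (sym (ℤ.pos-* (suc n + K) y))))

-- Since `n + 1 ≤ 2n`, already `2Cn / (n + 1) ≥ C`: the error term `2C / (n + 1)` times one factor
-- `n` of `n ^ s` absorbs the constant.
linear-beats-constant : ∀ {x C Q n s} → x ≤ C * Q → 1 ≤ n → 1 ≤ s →
  x * suc n ≤ (suc n + (C + C)) * (n ^ s * Q)
linear-beats-constant {x} {C} {Q} {n} {suc s} x≤CQ 1≤n@(s≤s _) _ = begin
  x * suc n                           ≤⟨ ℕ.*-mono-≤ x≤CQ (ℕ.+-monoˡ-≤ n 1≤n) ⟩
  C * Q * (n + n)                     ≡⟨ regroup C Q n ⟩
  (C + C) * (n * Q)                   ≤⟨ ℕ.*-mono-≤ (ℕ.m≤n+m (C + C) (suc n)) (ℕ.*-monoˡ-≤ Q n≤nˢ) ⟩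
  (suc n + (C + C)) * (n ^ suc s * Q) ∎
  where
  open ℕ.≤-Reasoning
  regroup : ∀ C Q n → C * Q * (n + n) ≡ (C + C) * (n * Q)
  regroup = solve-∀
  n≤nˢ : n ≤ n ^ suc s
  n≤nˢ = ℕ.m≤m*n n (n ^ s) {{ℕ.m^n≢0 n s}}

-- Splitting `n = m + (n ∸ m)` isolates a factor free of `n`; the extra colour joins it because the
-- power of `q` is at least 1.
degree-bound : ∀ q .{{_ : NonZero q}} {m n} t s → m ≤ n →
  suc ((q ^ m) ^ t * (q ^ n) ^ s) ≤ suc ((q ^ m) ^ t * (q ^ m) ^ s) * q ^ ((n ∸ m) * s)
degree-bound q {m} {n} t s m≤n = begin
  suc ((q ^ m) ^ t * (q ^ n) ^ s)           ≡⟨ cong (λ z → suc ((q ^ m) ^ t * z)) split ⟩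
  suc ((q ^ m) ^ t * ((q ^ m) ^ s * Q))     ≡⟨ cong suc (ℕ.*-assoc ((q ^ m) ^ t) ((q ^ m) ^ s) Q) ⟨
  suc ((q ^ m) ^ t * (q ^ m) ^ s * Q)       ≤⟨ ℕ.+-monoˡ-≤ _ (ℕ.m^n>0 q ((n ∸ m) * s)) ⟩
  suc ((q ^ m) ^ t * (q ^ m) ^ s) * Q       ∎
  where
  open ℕ.≤-Reasoning
  Q = q ^ ((n ∸ m) * s)
  split : (q ^ n) ^ s ≡ (q ^ m) ^ s * Q
  split = begin-equality
    (q ^ n) ^ s                   ≡⟨ ℕ.^-*-assoc q n s ⟩
    q ^ (n * s)                   ≡⟨ cong (λ z → q ^ (z * s)) (ℕ.m+[n∸m]≡n m≤n) ⟨
    q ^ ((m + (n ∸ m)) * s)       ≡⟨ cong (q ^_) (ℕ.*-distribʳ-+ s m (n ∸ m)) ⟩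
    q ^ (m * s + (n ∸ m) * s)     ≡⟨ ℕ.^-distribˡ-+-* q (m * s) ((n ∸ m) * s) ⟩
    q ^ (m * s) * Q               ≡⟨ cong (_* Q) (ℕ.^-*-assoc q m s) ⟨
    (q ^ m) ^ s * Q               ∎

primePower⇒2≤ : ∀ {q} → IsPrimePower q → 2 ≤ q
primePower⇒2≤ (p , suc k , p-prime , _ , refl) =
  ℕ.≤-trans (nonTrivial⇒n>1 p {{prime⇒nonTrivial p-prime}})
    (ℕ.m≤m*n p (p ^ k) {{ℕ.m^n≢0 p k {{prime⇒nonZero p-prime}}}})

J-chromatic-asymptotics : ∀ {c ℓ₁ ℓ₂} q m t s → 2 ≤ q → t + s ≡ m → 1 ≤ s → 1 ≤ m →
  ∃ λ (o : ℕ → ℚ) → TendsToZero o ×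
  (∀ n → 2 * m ≤ n → (F : HeytingField c ℓ₁ ℓ₂) → HasOrder F q →
  ∃ λ χ → IsChromaticNumber (J F n m t) χ ×
  (+ χ / 1) ℚ.≤ (1ℚ ℚ.+ o n) ℚ.* (+ (n ^ s * q ^ ((n ∸ m) * s)) / 1))
J-chromatic-asymptotics q m t s 2≤q t+s≡m 1≤s 1≤m =
  -- `C` involves only `q`, `m`, `t` and `s`, so the error term is fixed before `n` and the field.
  (λ n → + (C + C) / suc n) , /-vanishes (C + C) , λ n 2m≤n F order →
  let m≤n = ℕ.≤-trans (ℕ.m≤m+n m (m + 0)) 2m≤n
      χ , χ-chromatic , χ≤ = FiniteField.J-chromatic-bound {F = F} order 2≤q n m t t+s≡m
  in χ , χ-chromatic , ≤-scaled χ (n ^ s * q ^ ((n ∸ m) * s)) (C + C) n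
       (linear-beats-constant {Q = q ^ ((n ∸ m) * s)} {n} {s}
         (ℕ.≤-trans χ≤ (degree-bound q t s m≤n)) (ℕ.≤-trans 1≤m m≤n) 1≤s)
  where
  C = suc ((q ^ m) ^ t * (q ^ m) ^ s)
  instance
    q≢0 : NonZero q
    q≢0 = >-nonZero (ℕ.≤-trans (s≤s z≤n) 2≤q)

mainTheorem2 : ∀ {c ℓ₁ ℓ₂} (q m t : ℕ) → IsPrimePower q → 1 ≤ t → t ≤ m ∸ 1 →
    ∃ λ (o : ℕ → ℚ) → TendsToZero o ×
    (∀ n → 2 * m ≤ n → (F : HeytingField c ℓ₁ ℓ₂) → HasOrder F q →
    ∃ λ χ → IsChromaticNumber (J F n m t) χ ×
    (+ χ / 1) ℚ.≤ (1ℚ ℚ.+ o n) ℚ.* (+ (n ^ (m ∸ t) * q ^ ((n ∸ m) * (m ∸ t))) / 1))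
-- Truncated subtraction turns `m = 0` into `t ≤ 0`, against `1 ≤ t`.
mainTheorem2 q zero      (suc t) qpp 1≤t ()
mainTheorem2 q m@(suc _) t qpp 1≤t t≤m-1 =
  J-chromatic-asymptotics q m t (m ∸ t) (primePower⇒2≤ qpp)
    (ℕ.m+[n∸m]≡n (ℕ.m≤n⇒m≤1+n t≤m-1)) (ℕ.m<n⇒0<n∸m (s≤s t≤m-1)) (s≤s z≤n)
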